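{- There exist infinitely many $2$-layer $3$-planar graphs with $n$ vertices and $2n-4$ edges; that is, for infinitely many values of $n$ there is a $2$-layer $3$-planar graph with exactly $n$ vertices and exactly $2n-4$ edges.
   Context: All graphs are finite and simple (no loops or parallel edges). A topological $2$-layer graph is a bipartite graph $G=(U\,\dot\cup\,V,E)$, $E\subseteq U\times V$, drawn in the plane so that the vertices of $U$ and of $V$ are distinct points on two horizontal lines $L_u$ and $L_v$, respectively, and edges are $y$-monotone Jordan arcs; the drawing is assumed simple, i.e. adjacent edges do not cross and independent edges cross at most once. Denote the vertices by $u_1,\dots,u_p$ along $L_u$ and $v_1,\dots,v_q$ along $L_v$ in left-to-right order, $n=p+q$. (Thus edges $(u_i,v_x)$ and $(u_j,v_y)$ with $i<j$ cross if and only if $x>y$.) A topological $2$-layer graph is $k$-planar if each edge is crossed at most $k$ times. A bipartite graph is $2$-layer $k$-planar if it is isomorphic to the underlying abstract graph of some topological $2$-layer $k$-planar graph. -}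

module Defs where

open import Level using (0ℓ)
open import Data.Nat using (ℕ; _≤_)
open import Data.Fin using (Fin; _<_; _<?_)
open import Data.List using (List; length; filter; allFin; cartesianProduct)
open import Data.Product using (Σ-syntax; ∃-syntax; _×_; _,_; uncurry)
open import Data.Sum using (_⊎_; inj₁; inj₂)
open import Data.Empty using (⊥)
open import Function using (_⇔_; _↔_; Inverse)
open import Relation.Nullary using (¬_; no)
open import Relation.Nullary.Decidable using (_×-dec_; _⊎-dec_)
open import Relation.Unary using (Pred)
open import Relation.Binary using (Rel; REL; Decidable; Symmetric)
import Relation.Unary as U

allPairs : ∀ m n → List (Fin m × Fin n)
allPairs m n = cartesianProduct (allFin m) (allFin n)

count : ∀ {m n} {P : Pred (Fin m × Fin n) 0ℓ} → U.Decidable P → ℕ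
count {m} {n} P? = length (filter P? (allPairs m n))

record Graph (V : Set) : Set₁ where
  field
    Adj    : Rel V 0ℓ
    adj?   : Decidable Adj
    sym    : Symmetric Adj
    irrefl : ∀ {v} → ¬ Adj v v

-- Each undirected edge is counted once, as the pair (i , j) with i < j.
edgeCount : ∀ {n} → Graph (Fin n) → ℕ
edgeCount G = count λ (i , j) → (i <? j) ×-dec Graph.adj? G i j

_≅_ : ∀ {V W} → Graph V → Graph W → Set
_≅_ {V} {W} G H =
  Σ[ f ∈ V ↔ W ] (∀ a b → Graph.Adj G a b ⇔ Graph.Adj H (Inverse.to f a) (Inverse.to f b))

-- A topological 2-layer graph with p vertices on one line and q on the other,
-- each layer indexed from left to right.  The arcs are not recorded: in a
-- simple drawing with y-monotone arcs, the two vertex orders determine which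
-- edges cross, and any two edges cross at most once; conversely, straight
-- segments realise every such pair of orders and edge set.
record TwoLayer (p q : ℕ) : Set₁ where
  field
    Edge  : REL (Fin p) (Fin q) 0ℓ
    edge? : Decidable Edge

underlying : ∀ {p q} → TwoLayer p q → Graph (Fin p ⊎ Fin q)
underlying {p} {q} T = record
  { Adj = Adj ; adj? = adj? ; sym = λ {a} {b} → sym {a} {b} ; irrefl = λ {a} → irrefl {a} }
  where
  open TwoLayer T

  Adj : Rel (Fin p ⊎ Fin q) 0ℓ
  Adj (inj₁ u) (inj₂ v) = Edge u v
  Adj (inj₂ v) (inj₁ u) = Edge u v
  Adj (inj₁ _) (inj₁ _) = ⊥
  Adj (inj₂ _) (inj₂ _) = ⊥

  adj? : Decidable Adj
  adj? (inj₁ u) (inj₂ v) = edge? u v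
  adj? (inj₂ v) (inj₁ u) = edge? u v
  adj? (inj₁ _) (inj₁ _) = no λ ()
  adj? (inj₂ _) (inj₂ _) = no λ ()

  sym : Symmetric Adj
  sym {inj₁ _} {inj₂ _} e = e
  sym {inj₂ _} {inj₁ _} e = e

  irrefl : ∀ {a} → ¬ Adj a a
  irrefl {inj₁ _} ()
  irrefl {inj₂ _} ()

Cross : ∀ {p q} → Rel (Fin p × Fin q) 0ℓ
Cross (i , x) (j , y) = (i < j × y < x) ⊎ (j < i × x < y)

cross? : ∀ {p q} → Decidable (Cross {p} {q})
cross? (i , x) (j , y) = ((i <? j) ×-dec (y <? x)) ⊎-dec ((j <? i) ×-dec (x <? y))

crossings : ∀ {p q} → TwoLayer p q → Fin p × Fin q → ℕ
crossings T e = count λ f → uncurry (TwoLayer.edge? T) f ×-dec cross? e f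

KPlanar : ∀ {p q} → ℕ → TwoLayer p q → Set
KPlanar k T = ∀ u v → TwoLayer.Edge T u v → crossings T (u , v) ≤ k

-- Bipartiteness of G is not a separate hypothesis: it follows from the
-- isomorphism with an underlying graph.
TwoLayerKPlanar : ∀ {V} → ℕ → Graph V → Set₁
TwoLayerKPlanar k G =
  ∃[ p ] ∃[ q ] Σ[ T ∈ TwoLayer p q ] (KPlanar k T × G ≅ underlying T)

{-# OPTIONS --safe #-}
-- Two layers of m vertices each, with u_i adjacent to v_(i-1), v_i, v_(i+1),
-- v_(i+2) whenever these exist, give n = 2m and (m-1) + m + (m-1) + (m-2)
-- = 2n - 4 edges.  For an edge (u_i , v_j), a crossing edge starting to the
-- right of u_i is (i+1,i), (i+1,i+1) or (i+2,i+1) and forces i < j, while one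
-- starting to the left is (j,j+1), (j,j+2) or (j-1,j+1) and forces j ≤ i; so no
-- edge is crossed more than three times.
module Submission where

open import Level using (0ℓ)
open import Data.Nat using (ℕ; suc; pred; _+_; _*_; _≤_; z≤n; s≤s)
open import Data.Nat.Properties
  using (≤-reflexive; ≤-trans; ≤-antisym; ≤-pred; ≤-<-connex; 1+n≰n; <-asym;
         m≤n⇒m<n∨m≡n; m≤m+n; m≤n+m; +-cancelʳ-≡; +-monoˡ-≤;
         module ≤-Reasoning)
open import Data.Nat.Tactic.RingSolver using (solve-∀)
import Data.Nat as ℕ
import Data.Fin as Fin
open import Data.Fin using (Fin; toℕ; inject₁; _↑ˡ_; _↑ʳ_; splitAt)
open import Data.Fin.Properties
  using (toℕ-injective; toℕ-inject₁; inject₁-injective; toℕ<n; toℕ-↑ˡ; toℕ-↑ʳ;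
         ↑ˡ-injective; ↑ʳ-injective; splitAt-↑ˡ; splitAt-↑ʳ; splitAt⁻¹-↑ˡ;
         splitAt⁻¹-↑ʳ; +↔⊎)
open import Data.List using (List; []; _∷_; _++_; length; map; filter; allFin; tabulate)
open import Data.List.Properties using (length-map; length-++; length-tabulate)
open import Data.List.Membership.Propositional using (_∈_)
open import Data.List.Membership.Propositional.Properties
  using (∈-∃++; ∈-++⁺ˡ; ∈-++⁺ʳ; ∈-++⁻; ∈-map⁺; ∈-map⁻; ∈-filter⁺; ∈-filter⁻;
         ∈-allFin; ∈-cartesianProduct⁺)
import Data.List.Membership.DecPropositional as DecMembership
open import Data.List.Relation.Binary.Disjoint.Propositional using (Disjoint)
open import Data.List.Relation.Binary.Permutation.Propositional.Properties using (shift; ↭-length)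
open import Data.List.Relation.Binary.Subset.Propositional using (_⊆_)
open import Data.List.Relation.Unary.All as All using (All; []; _∷_)
import Data.List.Relation.Unary.All.Properties as All
open import Data.List.Relation.Unary.AllPairs using ([]; _∷_)
open import Data.List.Relation.Unary.Any using (here; there)
open import Data.List.Relation.Unary.Unique.Propositional using (Unique)
import Data.List.Relation.Unary.Unique.Propositional.Properties as Unique
open import Data.Product using (Σ-syntax; ∃-syntax; _×_; _,_; proj₁; proj₂; uncurry)
import Data.Product as Product
open import Data.Product.Properties using (≡-dec)
open import Data.Sum using (_⊎_; inj₁; inj₂)
open import Function using (_∘_; mk⇔; id)
open import Relation.Nullary using (contradiction)
open import Relation.Nullary.Decidable using (_×-dec_)
open import Relation.Binary.PropositionalEquality
  using (_≡_; _≢_; refl; sym; trans; cong; cong₂; subst; subst₂)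
import Relation.Unary as U
open import Defs

-- Pigeonhole, by induction on `xs`: one occurrence of the head is removed from `ys`, and uniqueness
-- keeps the tail inside what remains.
Unique-⊆⇒length≤ : ∀ {A : Set} {xs ys : List A} → Unique xs → xs ⊆ ys → length xs ≤ length ys
Unique-⊆⇒length≤ [] _ = z≤n
Unique-⊆⇒length≤ {xs = x ∷ xs} (x∉xs ∷ uxs) xs⊆ys with ∈-∃++ (xs⊆ys (here refl))
... | as , bs , refl =
  ≤-trans (s≤s (Unique-⊆⇒length≤ uxs rest)) (≤-reflexive (sym (↭-length (shift x as bs))))
  where
  rest : xs ⊆ as ++ bs
  rest y∈xs with ∈-++⁻ as (xs⊆ys (there y∈xs))
  ... | inj₁ y∈as         = ∈-++⁺ˡ y∈as
  ... | inj₂ (here refl)  = contradiction refl (All.lookup x∉xs y∈xs)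
  ... | inj₂ (there y∈bs) = ∈-++⁺ʳ as y∈bs

toℕ² : ∀ {m n} → Fin m × Fin n → ℕ × ℕ
toℕ² = Product.map toℕ toℕ

toℕ²-injective : ∀ {m n} {e f : Fin m × Fin n} → toℕ² e ≡ toℕ² f → e ≡ f
toℕ²-injective eq =
  cong₂ _,_ (toℕ-injective (cong proj₁ eq)) (toℕ-injective (cong proj₂ eq))

module _ {m n : ℕ} {P : U.Pred (Fin m × Fin n) 0ℓ} (P? : U.Decidable P) where

  satisfying : List (Fin m × Fin n)
  satisfying = filter P? (allPairs m n)

  satisfying-unique : Unique satisfying
  satisfying-unique =
    Unique.filter⁺ P? (Unique.cartesianProduct⁺ (Unique.allFin⁺ m) (Unique.allFin⁺ n))

  -- Reduces counting over the whole grid to listing: two duplicate-free lists with the same members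
  -- bound each other's length.
  count≡length : ∀ {xs} → Unique xs → (∀ {e} → P e → e ∈ xs) → (∀ {e} → e ∈ xs → P e) →
                 count P? ≡ length xs
  count≡length uxs P⇒∈ ∈⇒P = ≤-antisym
    (Unique-⊆⇒length≤ satisfying-unique (P⇒∈ ∘ proj₂ ∘ ∈-filter⁻ P? {xs = allPairs m n}))
    (Unique-⊆⇒length≤ uxs λ e∈xs →
      ∈-filter⁺ P? (∈-cartesianProduct⁺ (∈-allFin _) (∈-allFin _)) (∈⇒P e∈xs))

  -- The bounding list lives in ℕ × ℕ so that it may contain pairs outside the grid.
  count≤length : ∀ (xs : List (ℕ × ℕ)) → (∀ i j → P (i , j) → (toℕ i , toℕ j) ∈ xs) →
                 count P? ≤ length xs
  count≤length xs P⇒∈ = subst (_≤ length xs) (length-map toℕ² satisfying)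
    (Unique-⊆⇒length≤ (Unique.map⁺ toℕ²-injective satisfying-unique) image⊆xs)
    where
    image⊆xs : map toℕ² satisfying ⊆ xs
    image⊆xs e∈ with ∈-map⁻ toℕ² e∈
    ... | (i , j) , ij∈ , refl = P⇒∈ i j (proj₂ (∈-filter⁻ P? {xs = allPairs m n} ij∈))

module _ {p q : ℕ} where

  fromEdges : List (Fin p × Fin q) → TwoLayer p q
  fromEdges es = record { Edge = λ i j → (i , j) ∈ es ; edge? = λ i j → (i , j) ∈? es }
    where open DecMembership (≡-dec Fin._≟_ Fin._≟_) using (_∈?_)

  -- `edgeCount` needs vertices in some `Fin n`, while `underlying` has a disjoint sum. Pulling
  -- adjacency back along `splitAt` makes both adjacencies agree definitionally under `+↔⊎`.
  flatten : TwoLayer p q → Graph (Fin (p + q))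
  flatten T = record
    { Adj    = λ a b → Graph.Adj H (splitAt p a) (splitAt p b)
    ; adj?   = λ a b → Graph.adj? H (splitAt p a) (splitAt p b)
    ; sym    = λ {a} {b} → Graph.sym H {splitAt p a} {splitAt p b}
    ; irrefl = λ {a} → Graph.irrefl H {splitAt p a}
    }
    where H = underlying T

  flatten≅underlying : ∀ T → flatten T ≅ underlying T
  flatten≅underlying T = +↔⊎ , λ a b → mk⇔ id id

  place : Fin p × Fin q → Fin (p + q) × Fin (p + q)
  place (i , j) = i ↑ˡ q , p ↑ʳ j

  place-injective : ∀ {e f} → place e ≡ place f → e ≡ f
  place-injective eq =
    cong₂ _,_ (↑ˡ-injective q _ _ (cong proj₁ eq)) (↑ʳ-injective p _ _ (cong proj₂ eq))

  ↑ˡ<↑ʳ : ∀ (i : Fin p) (j : Fin q) → (i ↑ˡ q) Fin.< (p ↑ʳ j)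
  ↑ˡ<↑ʳ i j = begin
    suc (toℕ (i ↑ˡ q)) ≡⟨ cong suc (toℕ-↑ˡ i q) ⟩
    suc (toℕ i)        ≤⟨ toℕ<n i ⟩
    p                  ≤⟨ m≤m+n p (toℕ j) ⟩
    p + toℕ j          ≡⟨ toℕ-↑ʳ p j ⟨
    toℕ (p ↑ʳ j)       ∎
    where open ≤-Reasoning

  -- The first layer precedes the second in `Fin (p + q)`, so the increasing pair under which an
  -- edge is counted is exactly its `place`.
  edgeCount-flatten : ∀ {es} → Unique es → edgeCount (flatten (fromEdges es)) ≡ length es
  edgeCount-flatten {es} ues = trans
    (count≡length _ (Unique.map⁺ place-injective ues) adj⇒∈ ∈⇒adj)
    (length-map place es)
    where
    G = flatten (fromEdges es)

    adj⇒∈ : ∀ {e} → proj₁ e Fin.< proj₂ e × Graph.Adj G (proj₁ e) (proj₂ e) → e ∈ map place es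
    adj⇒∈ {a , b} (a<b , adj) with splitAt p a in eqa | splitAt p b in eqb
    ... | inj₁ i | inj₂ j = subst₂ (λ c d → (c , d) ∈ map place es)
          (splitAt⁻¹-↑ˡ eqa) (splitAt⁻¹-↑ʳ eqb) (∈-map⁺ place adj)
    ... | inj₂ j | inj₁ i = contradiction (↑ˡ<↑ʳ i j) (<-asym a<b′)
      where
      a<b′ : (p ↑ʳ j) Fin.< (i ↑ˡ q)
      a<b′ = subst₂ Fin._<_ (sym (splitAt⁻¹-↑ʳ eqa)) (sym (splitAt⁻¹-↑ˡ eqb)) a<b

    ∈⇒adj : ∀ {e} → e ∈ map place es → proj₁ e Fin.< proj₂ e × Graph.Adj G (proj₁ e) (proj₂ e)
    ∈⇒adj e∈ with ∈-map⁻ place e∈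
    -- Rewriting the `splitAt` calls lets adjacency reduce to membership of `(i , j)` in `es`.
    ... | (i , j) , ij∈es , refl rewrite splitAt-↑ˡ p i q | splitAt-↑ʳ p q j =
      ↑ˡ<↑ʳ i j , ij∈es

disjoint-++ʳ : ∀ {A : Set} {xs ys zs : List A} →
               Disjoint xs ys → Disjoint xs zs → Disjoint xs (ys ++ zs)
disjoint-++ʳ {ys = ys} xs#ys xs#zs (v∈xs , v∈ys++zs) with ∈-++⁻ ys v∈ys++zs
... | inj₁ v∈ys = xs#ys (v∈xs , v∈ys)
... | inj₂ v∈zs = xs#zs (v∈xs , v∈zs)

length-++-≡ : ∀ {A : Set} (xs : List A) {ys m n} →
              length xs ≡ m → length ys ≡ n → length (xs ++ ys) ≡ m + n
length-++-≡ xs |xs|≡m |ys|≡n = trans (length-++ xs) (cong₂ _+_ |xs|≡m |ys|≡n)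

n≤m≤1+n⇒m≡n∨m≡1+n : ∀ {m n} → n ≤ m → m ≤ suc n → m ≡ n ⊎ m ≡ suc n
n≤m≤1+n⇒m≡n∨m≡1+n n≤m m≤1+n with m≤n⇒m<n∨m≡n n≤m
... | inj₁ n<m = inj₂ (≤-antisym m≤1+n n<m)
... | inj₂ n≡m = inj₁ (sym n≡m)

-- The offsets -1, 0, 1, 2 of `j` from `i`, kept free of truncated subtraction.
InBand : ℕ → ℕ → Set
InBand i j = i ≤ 1 + j × j ≤ 2 + i

-- One endpoint suffices to fix each list. At `j = 0` the third left candidate repeats the first,
-- which is harmless in an upper bound.
rightCandidates leftCandidates : ℕ → List (ℕ × ℕ)
rightCandidates i = (1 + i , i) ∷ (1 + i , 1 + i) ∷ (2 + i , 1 + i) ∷ []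
leftCandidates  j = (j , 1 + j) ∷ (j , 2 + j) ∷ (pred j , 1 + j) ∷ []

-- The chain `1 + i ≤ k ≤ 1 + l ≤ j ≤ 2 + i` leaves two values for `k`: the larger forces
-- `l = 1 + i`, the smaller allows `i` or `1 + i`.
∈-rightCandidates : ∀ {i j k l} → j ≤ 2 + i → k ≤ 1 + l → i ℕ.< k → l ℕ.< j →
                    (k , l) ∈ rightCandidates i
∈-rightCandidates j≤2+i k≤1+l i<k l<j
  with n≤m≤1+n⇒m≡n∨m≡1+n i<k (≤-trans k≤1+l (≤-trans l<j j≤2+i))
... | inj₂ refl =
  there (there (here (cong (_ ,_) (≤-antisym (≤-pred (≤-trans l<j j≤2+i)) (≤-pred k≤1+l)))))
... | inj₁ refl with n≤m≤1+n⇒m≡n∨m≡1+n (≤-pred k≤1+l) (≤-pred (≤-trans l<j j≤2+i))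
...   | inj₁ refl = here refl
...   | inj₂ refl = there (here refl)

-- From `k < i ≤ 1 + j` comes `k ≤ j`, hence `1 + j ≤ l ≤ 2 + k ≤ 2 + j`. The larger value of `l`
-- forces `k = j`; the smaller also allows `j = 1 + k`.
∈-leftCandidates : ∀ {i j k l} → i ≤ 1 + j → l ≤ 2 + k → k ℕ.< i → j ℕ.< l →
                   (k , l) ∈ leftCandidates j
∈-leftCandidates i≤1+j l≤2+k k<i j<l
  with ≤-pred (≤-trans k<i i≤1+j)
... | k≤j with n≤m≤1+n⇒m≡n∨m≡1+n j<l (≤-trans l≤2+k (s≤s (s≤s k≤j)))
...   | inj₂ refl = there (here (cong (_, _) (≤-antisym k≤j (≤-pred (≤-pred l≤2+k)))))
...   | inj₁ refl with n≤m≤1+n⇒m≡n∨m≡1+n k≤j (≤-pred l≤2+k)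
...     | inj₁ refl = here refl
-- Here `j` has become `suc k`, so `pred j` computes to `k`.
...     | inj₂ refl = there (there (here refl))

-- Names the test inside `crossings`, so that `crossings T e` is `count (crossing? T e)` by
-- definition and `count≤length` applies.
crossing? : ∀ {p q} (T : TwoLayer p q) (e : Fin p × Fin q) →
            U.Decidable λ f → uncurry (TwoLayer.Edge T) f × Cross e f
crossing? T e f = uncurry (TwoLayer.edge? T) f ×-dec cross? e f

band-3-planar : ∀ {p q} (T : TwoLayer p q) →
                (∀ i j → TwoLayer.Edge T i j → InBand (toℕ i) (toℕ j)) → KPlanar 3 T
band-3-planar T inBand i j ij with inBand i j ij | ≤-<-connex (toℕ j) (toℕ i)
... | i≤1+j , j≤2+i | inj₂ i<j =
  count≤length (crossing? T (i , j)) (rightCandidates (toℕ i)) λ where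
    k l (kl , inj₁ (i<k , l<j)) →
      ∈-rightCandidates j≤2+i (proj₁ (inBand k l kl)) i<k l<j
    -- `k < i < j < l` would give `3 + k ≤ l`, against `l ≤ 2 + k`.
    k l (kl , inj₂ (k<i , j<l)) → contradiction
      (≤-trans (s≤s (≤-trans (s≤s k<i) i<j)) (≤-trans j<l (proj₂ (inBand k l kl)))) 1+n≰n
... | i≤1+j , j≤2+i | inj₁ j≤i =
  count≤length (crossing? T (i , j)) (leftCandidates (toℕ j)) λ where
    -- `l < j ≤ i < k` would give `2 + l ≤ k`, against `k ≤ 1 + l`.
    k l (kl , inj₁ (i<k , l<j)) → contradiction
      (≤-trans i<k (≤-trans (proj₁ (inBand k l kl)) (≤-trans l<j j≤i))) 1+n≰n
    k l (kl , inj₂ (k<i , j<l)) →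
      ∈-leftCandidates i≤1+j (proj₂ (inBand k l kl)) k<i j<l

-- The diagonal v - u = d - 1, shifted so that d is a natural number.
OnDiagonal : ∀ {p q} → ℕ → Fin p × Fin q → Set
OnDiagonal d (i , j) = 1 + toℕ j ≡ d + toℕ i

-- A shared edge satisfies both diagonal equations, and cancelling its first coordinate gives
-- `d ≡ d′`.
diagonals-disjoint : ∀ {p q d d′} {es fs : List (Fin p × Fin q)} → d ≢ d′ →
                     All (OnDiagonal d) es → All (OnDiagonal d′) fs → Disjoint es fs
diagonals-disjoint d≢d′ onD onD′ (e∈es , e∈fs) =
  d≢d′ (+-cancelʳ-≡ _ _ _ (trans (sym (All.lookup onD e∈es)) (All.lookup onD′ e∈fs)))

onDiagonal⇒inBand : ∀ {p q d} (e : Fin p × Fin q) → d ≤ 3 → OnDiagonal d e →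
                    InBand (toℕ (proj₁ e)) (toℕ (proj₂ e))
onDiagonal⇒inBand {d = d} (i , j) d≤3 eq =
  subst (toℕ i ≤_) (sym eq) (m≤n+m _ d) ,
  ≤-pred (≤-trans (≤-reflexive eq) (+-monoˡ-≤ (toℕ i) d≤3))

module _ (N : ℕ) where

  -- Layers of size `2 + N` give the diagonals lengths `1 + N`, `2 + N`, `1 + N`, `N` without
  -- subtraction. Each subscript is the `d` of `OnDiagonal`.
  edge₀ edge₂ : Fin (1 + N) → Fin (2 + N) × Fin (2 + N)
  edge₀ i = Fin.suc i , inject₁ i
  edge₂ i = inject₁ i , Fin.suc i

  edge₁ : Fin (2 + N) → Fin (2 + N) × Fin (2 + N)
  edge₁ i = i , i

  edge₃ : Fin N → Fin (2 + N) × Fin (2 + N)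
  edge₃ i = inject₁ (inject₁ i) , Fin.suc (Fin.suc i)

  diagonal₀ diagonal₁ diagonal₂ diagonal₃ bandEdges : List (Fin (2 + N) × Fin (2 + N))
  diagonal₀ = tabulate edge₀
  diagonal₁ = tabulate edge₁
  diagonal₂ = tabulate edge₂
  diagonal₃ = tabulate edge₃
  bandEdges = diagonal₀ ++ diagonal₁ ++ diagonal₂ ++ diagonal₃

  onDiagonal₀ : All (OnDiagonal 0) diagonal₀
  onDiagonal₀ = All.tabulate⁺ λ i → cong suc (toℕ-inject₁ i)

  onDiagonal₁ : All (OnDiagonal 1) diagonal₁
  onDiagonal₁ = All.tabulate⁺ {f = edge₁} λ i → refl

  onDiagonal₂ : All (OnDiagonal 2) diagonal₂
  onDiagonal₂ = All.tabulate⁺ λ i → cong (2 +_) (sym (toℕ-inject₁ i))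

  onDiagonal₃ : All (OnDiagonal 3) diagonal₃
  onDiagonal₃ = All.tabulate⁺ λ i →
    cong (3 +_) (sym (trans (toℕ-inject₁ (inject₁ i)) (toℕ-inject₁ i)))

  -- Within a diagonal the parametrisation is injective; the six pairs of diagonals are disjoint
  -- because their offsets differ.
  bandEdges-unique : Unique bandEdges
  bandEdges-unique =
    Unique.++⁺ (Unique.tabulate⁺ {f = edge₀} (inject₁-injective ∘ cong proj₂))
      (Unique.++⁺ (Unique.tabulate⁺ {f = edge₁} (cong proj₁))
        (Unique.++⁺ (Unique.tabulate⁺ {f = edge₂} (inject₁-injective ∘ cong proj₁))
          (Unique.tabulate⁺ {f = edge₃} (inject₁-injective ∘ inject₁-injective ∘ cong proj₁))
          (diagonals-disjoint (λ ()) onDiagonal₂ onDiagonal₃))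
        (disjoint-++ʳ (diagonals-disjoint (λ ()) onDiagonal₁ onDiagonal₂)
                      (diagonals-disjoint (λ ()) onDiagonal₁ onDiagonal₃)))
      (disjoint-++ʳ (diagonals-disjoint (λ ()) onDiagonal₀ onDiagonal₁)
        (disjoint-++ʳ (diagonals-disjoint (λ ()) onDiagonal₀ onDiagonal₂)
                      (diagonals-disjoint (λ ()) onDiagonal₀ onDiagonal₃)))

  bandEdges-inBand : All (λ (i , j) → InBand (toℕ i) (toℕ j)) bandEdges
  bandEdges-inBand =
    All.++⁺ (All.map (λ {e} → onDiagonal⇒inBand e (m≤m+n 0 3)) onDiagonal₀)
      (All.++⁺ (All.map (λ {e} → onDiagonal⇒inBand e (m≤m+n 1 2)) onDiagonal₁)
        (All.++⁺ (All.map (λ {e} → onDiagonal⇒inBand e (m≤m+n 2 1)) onDiagonal₂)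
                 (All.map (λ {e} → onDiagonal⇒inBand e (m≤m+n 3 0)) onDiagonal₃)))

  length-bandEdges : length bandEdges ≡ (1 + N) + ((2 + N) + ((1 + N) + N))
  length-bandEdges =
    length-++-≡ diagonal₀ (length-tabulate edge₀)
      (length-++-≡ diagonal₁ (length-tabulate edge₁)
        (length-++-≡ diagonal₂ (length-tabulate edge₂) (length-tabulate edge₃)))

theorem3 : ∀ (N : ℕ) → ∃[ n ] (N ≤ n × (Σ[ G ∈ Graph (Fin n) ] (TwoLayerKPlanar 3 G × edgeCount G + 4 ≡ 2 * n)))
theorem3 N =
  -- The requested lower bound `N` itself serves as the parameter of the construction.
  (2 + N) + (2 + N) ,
  ≤-trans (m≤n+m N 2) (m≤m+n (2 + N) (2 + N)) ,
  flatten T ,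
  (2 + N , 2 + N , T , band-3-planar T (λ i j → All.lookup (bandEdges-inBand N)) , flatten≅underlying T) ,
  -- The diagonals hold `4N + 4` edges in total; adding 4 gives twice the `2N + 4` vertices.
  trans (cong (_+ 4) (trans (edgeCount-flatten (bandEdges-unique N)) (length-bandEdges N)))
        (edges N)
  where
  T = fromEdges (bandEdges N)

  edges : ∀ N → (1 + N) + ((2 + N) + ((1 + N) + N)) + 4 ≡ 2 * ((2 + N) + (2 + N))
  edges = solve-∀
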